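{- Let $G$ be a graph and $F$ a forest, both on $n$ vertices, and suppose \[ 3\Delta(G)+\ell^*(F)\leq n. \] Then $G$ and $F$ pack, unless $n$ is even, $G=\frac{n}{2}K_2$ (a perfect matching), and $F=K_{1,n-1}$.
   Context: All graphs are finite and simple. $\Delta(G)$ is the maximum degree of $G$. Two graphs $G$ and $H$ on $n$ vertices pack if there is a bijection $f:V(G)\to V(H)$ such that for every edge $uv\in E(G)$, $f(u)f(v)\notin E(H)$. For a forest $F$, the number of excess leaves is $\ell^*(F)=\sum_{v\in V(F)}\max\{\deg_F(v)-2,0\}$ (equivalently, the number of leaves of $F$ minus twice the number of components of $F$ having at least two vertices). -}

module Defs where

open import Data.Nat using (ℕ; zero; suc; _+_; _*_; _∸_; _⊔_; _≤_; _/_)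
open import Data.Nat as ℕ using ()
open import Data.Bool using (Bool; true; false; if_then_else_; _∧_; _∨_; not)
open import Data.Fin using (Fin; toℕ)
open import Data.Fin as F using ()
open import Data.List using (List; []; _∷_; map; foldr; length; allFin)
open import Data.Nat.ListAction using (sum)
open import Data.List.Relation.Unary.Unique.Propositional using (Unique)
open import Data.Product using (Σ; _×_; _,_)
open import Relation.Binary.PropositionalEquality using (_≡_)
open import Relation.Nullary using (¬_)
open import Data.Unit using (⊤)
open import Data.Empty using (⊥)
open import Relation.Nullary.Decidable using (⌊_⌋)
open import Function.Bundles using (_⤖_; Bijection)

record Graph (n : ℕ) : Set where
  field
    adj    : Fin n → Fin n → Bool
    sym    : ∀ i j → adj i j ≡ adj j i
    irrefl : ∀ i → adj i i ≡ false
open Graph public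

deg : ∀ {n} → Graph n → Fin n → ℕ
deg {n} G v = sum (map (λ w → if adj G v w then 1 else 0) (allFin n))

-- maximum degree Δ(G) (0 for the empty vertex set)
Δ : ∀ {n} → Graph n → ℕ
Δ {n} G = foldr _⊔_ 0 (map (deg G) (allFin n))

Walk : ∀ {n} → Graph n → List (Fin n) → Set
Walk G []           = ⊤
Walk G (x ∷ [])     = ⊤
Walk G (x ∷ y ∷ xs) = (adj G x y ≡ true) × Walk G (y ∷ xs)

lastOf : ∀ {A : Set} → A → List A → A
lastOf v []       = v
lastOf v (w ∷ ws) = lastOf w ws

IsCycle : ∀ {n} → Graph n → List (Fin n) → Set
IsCycle G []       = ⊥
IsCycle G (v ∷ vs) =
  Unique (v ∷ vs) × (3 ≤ length (v ∷ vs)) × Walk G (v ∷ vs)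
  × (adj G (lastOf v vs) v ≡ true)

IsForest : ∀ {n} → Graph n → Set
IsForest {n} G = (c : List (Fin n)) → ¬ IsCycle G c

excessLeaves : ∀ {n} → Graph n → ℕ
excessLeaves {n} F = sum (map (λ v → deg F v ∸ 2) (allFin n))

Packs : ∀ {n} → Graph n → Graph n → Set
Packs {n} G H = Σ (Fin n ⤖ Fin n) λ f →
  ∀ u v → adj G u v ≡ true → adj H (Bijection.to f u) (Bijection.to f v) ≡ false

_≅ᵃ_ : ∀ {n} → Graph n → (Fin n → Fin n → Bool) → Set
_≅ᵃ_ {n} G a = Σ (Fin n ⤖ Fin n) λ f →
  ∀ u v → adj G u v ≡ a (Bijection.to f u) (Bijection.to f v)

-- the matching {0,1},{2,3},… on Fin n (for even n this is (n/2)K₂)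
matchingAdj : ∀ {n} → Fin n → Fin n → Bool
matchingAdj i j = ⌊ toℕ i / 2 ℕ.≟ toℕ j / 2 ⌋ ∧ not ⌊ toℕ i ℕ.≟ toℕ j ⌋

isZero : ∀ {n} → Fin n → Bool
isZero i = ⌊ toℕ i ℕ.≟ 0 ⌋

starAdj : ∀ {n} → Fin n → Fin n → Bool
starAdj i j = (isZero i ∧ not (isZero j)) ∨ (isZero j ∧ not (isZero i))

{-# OPTIONS --safe #-}

-- Let u be a leaf of F with neighbour v, and suppose that G and F − uv already pack; relabel G
-- so that they share the vertex set and uv is the only common edge. Trading the places of
-- u and w repairs this unless w lies in N_G[v] or in N_F(N_G(u)). Counting gives at most
-- 3Δ(G) + ℓ*(F) ≤ n such w, so failure forces equality throughout: deg u = deg v = Δ in G, every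
-- vertex of N_G(u) has F-degree at least 2, all F-vertices of degree at least 3 ("hubs") lie in
-- N_G(u), and each vertex outside N_G[v] has exactly one F-neighbour in N_G(u).
--
-- This excludes deg_F v = 2 by a rotation, so every leaf hangs on a hub. Choose u, v, y as the
-- beginning of a longest path of F, so that all neighbours of v except y are leaves. If Δ(G) = 1,
-- then F is a star and G a perfect matching. Otherwise there is a second hub h carrying a leaf.
-- Since all placements obtained by trading u with a neighbour of v are tight as well, v and h
-- are closed twins in G. Moving v to the place of y then leaves only conflicts between v and
-- its leaves, none of which is adjacent to h, and these are repaired one at a time because
-- the degree of h is missing from the count.
module Submission where

open import Defs hiding (sym)
open import Data.Bool using (Bool; true; false; if_then_else_; _∧_; _∨_; not)
import Data.Bool.Properties as Bool
open import Data.Empty using (⊥; ⊥-elim)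
open import Data.Fin using (Fin; zero; suc; _≟_; toℕ)
open import Data.Fin.Permutation using (Permutation′; _⟨$⟩ʳ_; _⟨$⟩ˡ_; inverseˡ; inverseʳ; transpose; flip; permutation; lift₀; _∘ₚ_) renaming (id to idₚ)
open import Data.Fin.Properties using (any?; all?; injective⇒≤) renaming (suc-injective to Fin-suc-injective)
import Data.List as List
open import Data.List using (List; []; _∷_; allFin; length; reverse; _ʳ++_)
open import Data.List.Membership.Propositional using (_∈_; _∉_)
open import Data.List.Membership.Propositional.Properties using (∈-allFin; ∈-lookup)
open import Data.List.Properties using (map-tabulate; length-reverse)
open import Data.List.Relation.Binary.Permutation.Propositional using (↭⇒↭ₛ; ↭-sym)
open import Data.List.Relation.Binary.Permutation.Propositional.Properties using (↭-reverse)
import Data.List.Relation.Binary.Permutation.Setoid.Properties as PermSetoid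
open import Data.List.Relation.Unary.All as All using (All; []; _∷_)
open import Data.List.Relation.Unary.All.Properties using (¬Any⇒All¬)
open import Data.List.Relation.Unary.AllPairs using ([]; _∷_)
open import Data.List.Relation.Unary.Any using (here; there)
open import Data.List.Relation.Unary.Unique.DecPropositional using (unique?)
open import Data.List.Relation.Unary.Unique.Propositional using (Unique)
import Data.Nat as ℕ
open import Data.Nat using (ℕ; zero; suc; _+_; _*_; _∸_; _≤_; _<_; z≤n; s≤s; _⊔_; _≤?_)
open import Data.Nat.DivMod using (_/_; m/n≡1+[m∸n]/n)
open import Data.Nat.Divisibility using (_∣_; _∣0; ∣m∣n⇒∣m+n; ∣-refl)
import Data.Nat.ListAction as ListAction
open import Data.Nat.Properties hiding (_≟_)
open import Data.Product using (∃; _×_; _,_; proj₁; proj₂)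
open import Data.Sum using (_⊎_; inj₁; inj₂)
open import Data.Unit using (tt)
open import Data.Vec using (Vec; []; _∷_; lookup; tabulate; toList; fromList)
open import Data.Vec.Properties using (lookup∘tabulate; toList∘fromList; length-toList)
open import Algebra.Properties.Semiring.Sum +-*-semiring using (sum; sum-replicate-zero; sum-cong-≗; sum-permute; ∑-distrib-+; ∑-comm; *-distribˡ-sum)
open import Function using (_∘_; id)
open import Function.Bundles using (Bijection; mk⇔)
open import Function.Properties.Bijection using (⤖⇒↔)
open import Function.Properties.Inverse using (↔⇒⤖)
open import Relation.Binary.PropositionalEquality using (_≡_; _≢_; refl; sym; trans; cong; cong₂; subst; subst₂; ≢-sym; setoid)
open import Relation.Nullary using (¬_; Dec; yes; no; does)
open import Relation.Nullary.Decidable using (map′; _×-dec_; _⊎-dec_; _→-dec_; ¬?; ⌊_⌋; does-⇔; dec-true; dec-false)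

-- Finite sums


ind : Bool → ℕ
ind b = if b then 1 else 0

ind-true : ∀ {b} → b ≡ true → ind b ≡ 1
ind-true refl = refl

ind-false : ∀ {b} → ¬ (b ≡ true) → ind b ≡ 0
ind-false {true}  ¬t = ⊥-elim (¬t refl)
ind-false {false} ¬t = refl

ind-zero : ∀ {b} → ind b ≡ 0 → ¬ (b ≡ true)
ind-zero {false} _ ()

ind-pos : ∀ {b} → 1 ≤ ind b → b ≡ true
ind-pos {true} _ = refl

δ : ∀ {n} → Fin n → Fin n → ℕ
δ v w = ind (does (v ≟ w))

δ-refl : ∀ {n} (v : Fin n) → δ v v ≡ 1
δ-refl v with v ≟ v
... | yes _ = refl
... | no v≢v = ⊥-elim (v≢v refl)

δ-≢ : ∀ {n} {v w : Fin n} → v ≢ w → δ v w ≡ 0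
δ-≢ {v = v} {w} v≢w with v ≟ w
... | yes v≡w = ⊥-elim (v≢w v≡w)
... | no _ = refl

sum-mono : ∀ {n} {f g : Fin n → ℕ} → (∀ i → f i ≤ g i) → sum f ≤ sum g
sum-mono {zero}  f≤g = z≤n
sum-mono {suc n} f≤g = +-mono-≤ (f≤g zero) (sum-mono (f≤g ∘ suc))

sum-δ : ∀ {n} (v : Fin n) → sum (δ v) ≡ 1
sum-δ {suc n} zero    = cong suc (sum-replicate-zero n)
sum-δ {suc n} (suc v) = sum-δ v

sum-one : ∀ n → sum {n} (λ _ → 1) ≡ n
sum-one zero    = refl
sum-one (suc n) = cong suc (sum-one n)

term≤sum : ∀ {n} (f : Fin n → ℕ) i → f i ≤ sum f
term≤sum f zero    = m≤m+n _ _
term≤sum f (suc i) = ≤-trans (term≤sum (f ∘ suc) i) (m≤n+m _ _)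

sum-pos : ∀ {n} (f : Fin n → ℕ) → 1 ≤ sum f → ∃ λ i → 1 ≤ f i
sum-pos {suc n} f p with f zero in eq
... | suc _ = zero , subst (1 ≤_) (sym eq) (s≤s z≤n)
... | zero with sum-pos (f ∘ suc) p
...   | i , q = suc i , q

two≤sum : ∀ {n} (f : Fin n → ℕ) {a b} → a ≢ b → 1 ≤ f a → 1 ≤ f b → 2 ≤ sum f
two≤sum f {a} {b} a≢b fa fb = subst (_≤ sum f)
  (trans (∑-distrib-+ (δ a) (δ b)) (cong₂ _+_ (sum-δ a) (sum-δ b))) (sum-mono le)
  where
  le : ∀ w → δ a w + δ b w ≤ f w
  le w with a ≟ w | b ≟ w
  ... | yes refl | yes refl = ⊥-elim (a≢b refl)
  ... | yes refl | no _     = fa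
  ... | no _     | yes refl = fb
  ... | no _     | no _     = z≤n

three≤sum : ∀ {n} (f : Fin n → ℕ) {a b c} → a ≢ b → a ≢ c → b ≢ c →
            1 ≤ f a → 1 ≤ f b → 1 ≤ f c → 3 ≤ sum f
three≤sum f {a} {b} {c} a≢b a≢c b≢c fa fb fc = subst (_≤ sum f)
  (trans (∑-distrib-+ (δ a) _)
    (cong₂ _+_ (sum-δ a) (trans (∑-distrib-+ (δ b) (δ c)) (cong₂ _+_ (sum-δ b) (sum-δ c)))))
  (sum-mono le)
  where
  le : ∀ w → δ a w + (δ b w + δ c w) ≤ f w
  le w with a ≟ w | b ≟ w | c ≟ w
  ... | yes refl | yes refl | _        = ⊥-elim (a≢b refl)
  ... | yes refl | no _     | yes refl = ⊥-elim (a≢c refl)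
  ... | yes refl | no _     | no _     = fa
  ... | no _     | yes refl | yes refl = ⊥-elim (b≢c refl)
  ... | no _     | yes refl | no _     = fb
  ... | no _     | no _     | yes refl = fc
  ... | no _     | no _     | no _     = z≤n

-- Compares `f` with the constant 1 plus `δ a`. Applied to the loads below, where the leaf is loaded
-- twice, it meets the upper bound `suc n` on the total load.
n<sum : ∀ {n} (f : Fin n → ℕ) {a} → (∀ w → 1 ≤ f w) → 2 ≤ f a → suc n ≤ sum f
n<sum {n} f {a} pos fa = subst (_≤ sum f)
  (trans (∑-distrib-+ (δ a) (λ _ → 1)) (cong₂ _+_ (sum-δ a) (sum-one n))) (sum-mono le)
  where
  le : ∀ w → δ a w + 1 ≤ f w
  le w with a ≟ w
  ... | yes refl = fa
  ... | no _     = pos w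

1+n<sum : ∀ {n} (f : Fin n → ℕ) {a b} → a ≢ b → (∀ w → 1 ≤ f w) →
          2 ≤ f a → 2 ≤ f b → suc (suc n) ≤ sum f
1+n<sum {n} f {a} {b} a≢b pos fa fb = subst (_≤ sum f)
  (trans (∑-distrib-+ (δ a) _)
    (cong₂ _+_ (sum-δ a) (trans (∑-distrib-+ (δ b) (λ _ → 1)) (cong₂ _+_ (sum-δ b) (sum-one n)))))
  (sum-mono le)
  where
  le : ∀ w → δ a w + (δ b w + 1) ≤ f w
  le w with a ≟ w | b ≟ w
  ... | yes refl | yes refl = ⊥-elim (a≢b refl)
  ... | yes refl | no _     = fa
  ... | no _     | yes refl = fb
  ... | no _     | no _     = pos w

listSum≡sum : ∀ {n} (f : Fin n → ℕ) → ListAction.sum (List.map f (allFin n)) ≡ sum f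
listSum≡sum {n} f = trans (cong ListAction.sum (map-tabulate id f)) (go f)
  where
  go : ∀ {m} (g : Fin m → ℕ) → ListAction.sum (List.tabulate g) ≡ sum g
  go {zero}  g = refl
  go {suc m} g = cong (g zero +_) (go (g ∘ suc))

-- Degrees

Adj : ∀ {n} → Graph n → Fin n → Fin n → Set
Adj G x y = adj G x y ≡ true

adj? : ∀ {n} (G : Graph n) x y → Dec (Adj G x y)
adj? G x y = adj G x y Bool.≟ true

module _ {n} (G : Graph n) where

  Adj-sym : ∀ {x y} → Adj G x y → Adj G y x
  Adj-sym {x} {y} p = trans (Graph.sym G y x) p

  Adj⇒≢ : ∀ {x y} → Adj G x y → x ≢ y
  Adj⇒≢ {x} p refl with trans (sym p) (Graph.irrefl G x)
  ... | ()

  Adj-≢ : ∀ {x y z} → Adj G x y → ¬ Adj G x z → y ≢ z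
  Adj-≢ p ¬q refl = ¬q p

  deg≡sum : ∀ v → deg G v ≡ sum (λ w → ind (adj G v w))
  deg≡sum v = listSum≡sum (λ w → ind (adj G v w))

  deg≤Δ : ∀ v → deg G v ≤ Δ G
  deg≤Δ v = go (∈-allFin v)
    where
    go : ∀ {xs} → v ∈ xs → deg G v ≤ List.foldr _⊔_ 0 (List.map (deg G) xs)
    go (here refl) = m≤m⊔n _ _
    go (there p)   = ≤-trans (go p) (m≤n⊔m _ _)

  private
    one≤ : ∀ {x y} → Adj G x y → 1 ≤ ind (adj G x y)
    one≤ p = ≤-reflexive (sym (ind-true p))

  neighbour : ∀ {x} → 1 ≤ deg G x → ∃ λ y → Adj G x y
  neighbour {x} p with sum-pos _ (subst (1 ≤_) (deg≡sum x) p)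
  ... | y , q = y , ind-pos q

  deg≥2 : ∀ {x a b} → a ≢ b → Adj G x a → Adj G x b → 2 ≤ deg G x
  deg≥2 {x} a≢b p q = subst (2 ≤_) (sym (deg≡sum x)) (two≤sum _ a≢b (one≤ p) (one≤ q))

  deg≥3 : ∀ {x a b c} → a ≢ b → a ≢ c → b ≢ c →
          Adj G x a → Adj G x b → Adj G x c → 3 ≤ deg G x
  deg≥3 {x} a≢b a≢c b≢c p q r = subst (3 ≤_) (sym (deg≡sum x))
    (three≤sum _ a≢b a≢c b≢c (one≤ p) (one≤ q) (one≤ r))

  deg≤1 : ∀ {x y} → (∀ {w} → Adj G x w → w ≡ y) → deg G x ≤ 1
  deg≤1 {x} {y} only = subst₂ _≤_ (sym (deg≡sum x)) (sum-δ y) (sum-mono le)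
    where
    le : ∀ w → ind (adj G x w) ≤ δ y w
    le w with adj? G x w
    ... | no ¬p = subst (_≤ δ y w) (sym (ind-false ¬p)) z≤n
    ... | yes p with only p
    ...   | refl = ≤-reflexive (trans (ind-true p) (sym (δ-refl y)))

  another-neighbour : ∀ {x} → 2 ≤ deg G x → ∀ y → ∃ λ z → z ≢ y × Adj G x z
  another-neighbour {x} p y with any? (λ z → ¬? (z ≟ y) ×-dec adj? G x z)
  ... | yes q = q
  ... | no ¬q = ⊥-elim (<⇒≱ p (deg≤1 only))
    where
    only : ∀ {w} → Adj G x w → w ≡ y
    only {w} r with w ≟ y
    ... | yes w≡y = w≡y
    ... | no w≢y  = ⊥-elim (¬q (w , w≢y , r))

-- Degree one is stated through its unique neighbour, the form in which exchanges use it. The same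
-- record describes the edges of a perfect matching.
record Leaf {n} (F : Graph n) (u v : Fin n) : Set where
  constructor leaf
  field
    edge : Adj F u v
    only : ∀ {w} → Adj F u w → w ≡ v
open Leaf

-- Relabelling

-- A placement of `G` on the vertices of `F`: position `i` holds the vertex `π ⟨$⟩ʳ i` of `G`.
relabel : ∀ {n} → Permutation′ n → Graph n → Graph n
relabel π G .adj i j    = adj G (π ⟨$⟩ʳ i) (π ⟨$⟩ʳ j)
relabel π G .Graph.sym i j = Graph.sym G _ _
relabel π G .irrefl i   = Graph.irrefl G _

deg-relabel : ∀ {n} (π : Permutation′ n) (G : Graph n) v → deg (relabel π G) v ≡ deg G (π ⟨$⟩ʳ v)
deg-relabel π G v = trans (deg≡sum (relabel π G) v)
  (trans (sym (sum-permute _ π)) (sym (deg≡sum G (π ⟨$⟩ʳ v))))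

EdgeDisjoint : ∀ {n} → Graph n → Graph n → Set
EdgeDisjoint G F = ∀ i j → Adj F i j → ¬ Adj G i j

-- `Packs` asks for a map out of `G`, whereas `π` runs from positions to vertices of `G`; hence the
-- `flip`.
disjoint⇒packs : ∀ {n} {G F : Graph n} (π : Permutation′ n) → EdgeDisjoint (relabel π G) F → Packs G F
disjoint⇒packs {G = G} {F} π disj = ↔⇒⤖ (flip π) , λ u v p → Bool.¬-not λ q →
  disj _ _ q (subst₂ (Adj G) (sym (inverseʳ π)) (sym (inverseʳ π)) p)

packs⇒disjoint : ∀ {n} {G F : Graph n} → Packs G F → ∃ λ π → EdgeDisjoint (relabel π G) F
packs⇒disjoint {G = G} {F} (f , h) = π , λ i j p q → ⊥-elim (Bool.not-¬ (trans (sym (eq i j)) (h _ _ q)) p)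
  where
  π = flip (⤖⇒↔ f)
  eq : ∀ i j → adj F (Bijection.to f (π ⟨$⟩ʳ i)) (Bijection.to f (π ⟨$⟩ʳ j)) ≡ adj F i j
  eq i j = cong₂ (adj F) (inverseˡ π) (inverseˡ π)

packs-relabel : ∀ {n} {G F : Graph n} (π : Permutation′ n) → Packs (relabel π G) F → Packs G F
packs-relabel {G = G} {F} π (f , h) = ↔⇒⤖ (flip π ∘ₚ ⤖⇒↔ f) , λ u v p →
  h _ _ (subst₂ (Adj G) (sym (inverseʳ π)) (sym (inverseʳ π)) p)

-- Deciding whether two graphs pack

anyVec? : ∀ {m k} {P : Vec (Fin m) k → Set} → (∀ v → Dec (P v)) → Dec (∃ P)
anyVec? {k = zero}  P? = map′ (λ p → [] , p) (λ { ([] , p) → p }) (P? [])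
anyVec? {k = suc k} P? = map′ (λ { (i , v , p) → i ∷ v , p }) (λ { (i ∷ v , p) → i , v , p })
  (any? (λ i → anyVec? (λ v → P? (i ∷ v))))

-- Searches over value tables for a map together with its inverse, so that bijectivity becomes a
-- pointwise decidable condition.
packs? : ∀ {n} (G F : Graph n) → Dec (Packs G F)
packs? {n} G F = map′ to from (anyVec? λ f → anyVec? λ g →
    all? (λ i → lookup f (lookup g i) ≟ i) ×-dec
    all? (λ i → lookup g (lookup f i) ≟ i) ×-dec
    all? (λ i → all? (λ j → adj? F i j →-dec ¬? (adj? G (lookup f i) (lookup f j)))))
  where
  Certificate : Vec (Fin n) n → Vec (Fin n) n → Set
  Certificate f g = (∀ i → lookup f (lookup g i) ≡ i) × (∀ i → lookup g (lookup f i) ≡ i) ×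
    (∀ i j → Adj F i j → ¬ Adj G (lookup f i) (lookup f j))
  to : ∃ (λ f → ∃ (Certificate f)) → Packs G F
  to (f , g , fg , gf , h) = disjoint⇒packs {G = G} {F} (permutation (lookup f) (lookup g) fg gf) h
  from : Packs G F → ∃ λ f → ∃ (Certificate f)
  from p with packs⇒disjoint {G = G} {F} p
  ... | π , h = tabulate (π ⟨$⟩ʳ_) , tabulate (π ⟨$⟩ˡ_) ,
    (λ i → trans (lookup∘tabulate (π ⟨$⟩ʳ_) _)
      (trans (cong (π ⟨$⟩ʳ_) (lookup∘tabulate (π ⟨$⟩ˡ_) i)) (inverseʳ π))) ,
    (λ i → trans (lookup∘tabulate (π ⟨$⟩ˡ_) _)
      (trans (cong (π ⟨$⟩ˡ_) (lookup∘tabulate (π ⟨$⟩ʳ_) i)) (inverseˡ π))) ,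
    λ i j e → h i j e ∘ subst₂ (Adj G) (lookup∘tabulate _ i) (lookup∘tabulate _ j)

-- Exchanging two vertices

transpose-left : ∀ {n} (a b : Fin n) → transpose a b ⟨$⟩ʳ a ≡ b
transpose-left a b with a ≟ a
... | yes _  = refl
... | no a≢a = ⊥-elim (a≢a refl)

transpose-right : ∀ {n} (a b : Fin n) → transpose a b ⟨$⟩ʳ b ≡ a
transpose-right a b with b ≟ a
... | yes b≡a = b≡a
... | no _ with b ≟ b
...   | yes _  = refl
...   | no b≢b = ⊥-elim (b≢b refl)

transpose-other : ∀ {n} {a b c : Fin n} → c ≢ a → c ≢ b → transpose a b ⟨$⟩ʳ c ≡ c
transpose-other {a = a} {b} {c} c≢a c≢b with c ≟ a
... | yes c≡a = ⊥-elim (c≢a c≡a)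
... | no _ with c ≟ b
...   | yes c≡b = ⊥-elim (c≢b c≡b)
...   | no _    = refl

exchange : ∀ {n} → Fin n → Fin n → Graph n → Graph n
exchange a b = relabel (transpose a b)

module _ {n} (F G : Graph n) (P : Fin n → Fin n → Set) (P-sym : ∀ {i j} → P i j → P j i)
  {a b : Fin n}
  (inner : Adj F a b → Adj G b a → P a b)
  (at-a  : ∀ j → j ≢ a → j ≢ b → Adj F a j → Adj G b j → P a j)
  (at-b  : ∀ j → j ≢ a → j ≢ b → Adj F b j → Adj G a j → P b j)
  (outer : ∀ i j → i ≢ a → i ≢ b → j ≢ a → j ≢ b → Adj F i j → Adj G i j → P i j)
  where

  private
    move : ∀ i j {i′ j′} → transpose a b ⟨$⟩ʳ i ≡ i′ → transpose a b ⟨$⟩ʳ j ≡ j′ →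
           Adj (exchange a b G) i j → Adj G i′ j′
    move i j = subst₂ (Adj G)

    from-a : ∀ {j} → Dec (j ≡ a) → Dec (j ≡ b) → Adj F a j → Adj (exchange a b G) a j → P a j
    from-a (yes refl) _          e c = ⊥-elim (Adj⇒≢ F e refl)
    from-a (no _)     (yes refl) e c = inner e (move a b (transpose-left a b) (transpose-right a b) c)
    from-a {j} (no p) (no q)     e c = at-a j p q e (move a j (transpose-left a b) (transpose-other p q) c)

    from-b : ∀ {j} → Dec (j ≡ a) → Dec (j ≡ b) → Adj F b j → Adj (exchange a b G) b j → P b j
    from-b _          (yes refl) e c = ⊥-elim (Adj⇒≢ F e refl)
    from-b (yes refl) (no p)     e c =
      P-sym (from-a (no (p ∘ sym)) (yes refl) (Adj-sym F e) (Adj-sym (exchange a b G) {b} {a} c))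
    from-b {j} (no p) (no q)     e c = at-b j p q e (move b j (transpose-right a b) (transpose-other p q) c)

    from : ∀ i j → Dec (i ≡ a) → Dec (i ≡ b) → Dec (j ≡ a) → Dec (j ≡ b) →
           Adj F i j → Adj (exchange a b G) i j → P i j
    from i j (yes refl) _ p q e c = from-a p q e c
    from i j (no _) (yes refl) p q e c = from-b p q e c
    from i j p@(no _) q@(no _) (yes refl) _ e c =
      P-sym (from-a p q (Adj-sym F e) (Adj-sym (exchange a b G) {i} {j} c))
    from i j p@(no _) q@(no _) (no _) (yes refl) e c =
      P-sym (from-b p q (Adj-sym F e) (Adj-sym (exchange a b G) {i} {j} c))
    from i j (no p) (no q) (no r) (no s) e c =
      outer i j p q r s e (move i j (transpose-other p q) (transpose-other r s) c)

  -- After the exchange position `a` holds `b` and conversely. Conflicts are thus sorted by how an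
  -- edge of `F` meets `a` and `b`, and the four premises mention only adjacency in the original
  -- `G`.
  exchange-elim : ∀ i j → Adj F i j → Adj (exchange a b G) i j → P i j
  exchange-elim i j = from i j (i ≟ a) (i ≟ b) (j ≟ a) (j ≟ b)

-- Counting the obstructions to moving a leaf

-- `D` stands for the maximum degree: one number bounds the degrees in all placements of `G`, so no
-- recomputation is due after relabelling.
module Core {n} (F : Graph n) (D : ℕ) (bound : 3 * D + excessLeaves F ≤ n) where

  Bounded : Graph n → Set
  Bounded G = ∀ v → deg G v ≤ D

  relabel-bounded : ∀ G π → Bounded G → Bounded (relabel π G)
  relabel-bounded G π b v = subst (_≤ D) (sym (deg-relabel π G v)) (b _)

  module _ (G : Graph n) (u v : Fin n) where

    covers : Fin n → Fin n → ℕ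
    covers x w = ind (adj G u x) * ind (adj F x w)

    -- Counts the reasons for which the leaf u (with neighbour v) cannot trade places with w.
    load : Fin n → ℕ
    load w = δ v w + (ind (adj G v w) + sum (λ x → covers x w))

    -- What vertex x of F contributes less than its maximum to the total load.
    slack : Fin n → ℕ
    slack x = if adj G u x then 2 ∸ deg F x else deg F x ∸ 2

    -- Double counting: after exchanging the two summations, each `G`-neighbour `x` of `u`
    -- contributes its `F`-degree.
    sum-load : sum load ≡ suc (deg G v + sum (λ x → ind (adj G u x) * deg F x))
    sum-load = trans (∑-distrib-+ (δ v) _) (cong₂ _+_ (sum-δ v)
      (trans (∑-distrib-+ (λ w → ind (adj G v w)) (λ w → sum (λ x → covers x w)))
        (cong₂ _+_ (sym (deg≡sum G v)) (trans (sym (∑-comm covers)) (sum-cong-≗ λ x →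
          trans (sym (*-distribˡ-sum (ind (adj G u x)) (λ w → ind (adj F x w))))
            (cong (ind (adj G u x) *_) (sym (deg≡sum F x))))))))

    -- Holds term by term: a `G`-neighbour of `u` with `F`-degree d satisfies d + (2 ∸ d) = 2 + (d ∸
    -- 2), and any other vertex has d ∸ 2 on both sides.
    sum-slack : sum (λ x → ind (adj G u x) * deg F x) + sum slack ≡ 2 * deg G u + excessLeaves F
    sum-slack = trans (sym (∑-distrib-+ (λ x → ind (adj G u x) * deg F x) slack))
      (trans (sum-cong-≗ pointwise)
      (trans (∑-distrib-+ (λ x → 2 * ind (adj G u x)) _) (cong₂ _+_
        (trans (sym (*-distribˡ-sum 2 (λ x → ind (adj G u x)))) (cong (2 *_) (sym (deg≡sum G u))))
        (sym (listSum≡sum (λ x → deg F x ∸ 2))))))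
      where
      max : ∀ d → d + 0 + (2 ∸ d) ≡ 2 + (d ∸ 2)
      max 0 = refl
      max 1 = refl
      max (suc (suc d)) = cong (2 +_) (trans (cong₂ _+_ (+-identityʳ d) (0∸n≡0 d)) (+-identityʳ d))
      pointwise : ∀ x → ind (adj G u x) * deg F x + slack x ≡ 2 * ind (adj G u x) + (deg F x ∸ 2)
      pointwise x with adj G u x
      ... | true  = max (deg F x)
      ... | false = refl

    load-total : sum load + sum slack ≡ suc (deg G v + (2 * deg G u + excessLeaves F))
    load-total = trans (cong (_+ sum slack) sum-load)
      (cong suc (trans (+-assoc (deg G v) _ _) (cong (deg G v +_) sum-slack)))

    -- The numerical hypothesis enters here: `deg G v` uses one copy of `D`, `2 * deg G u` the other
    -- two, and the extra 1 comes from `δ v`.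
    load-total≤ : Bounded G → sum load + sum slack ≤ suc n
    load-total≤ b = ≤-trans (≤-reflexive load-total) (s≤s (≤-trans
      (+-mono-≤ (b v) (+-monoˡ-≤ (excessLeaves F) (*-monoʳ-≤ 2 (b u))))
      (≤-trans (≤-reflexive (sym (+-assoc D (2 * D) _))) bound)))

    covered⇒load : ∀ {x w} → Adj G u x → Adj F x w → 1 ≤ sum (λ x → covers x w)
    covered⇒load {x} {w} p q = ≤-trans
      (≤-reflexive (sym (cong₂ _*_ (ind-true p) (ind-true q)))) (term≤sum (λ x → covers x w) x)

    -- The vertex `u` is counted once as a `G`-neighbour of `v`, and once because `v` itself lies in
    -- N_G(u) and is `F`-adjacent to `u`.
    load-leaf : Adj G u v → Leaf F u v → 2 ≤ load u
    load-leaf p l = ≤-trans (+-mono-≤ (≤-reflexive (sym (ind-true (Adj-sym G p))))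
      (covered⇒load p (Adj-sym F (edge l)))) (m≤n+m _ (δ v u))

    record Free (w : Fin n) : Set where
      field
        ≢v         : w ≢ v
        nonadj     : ¬ Adj G v w
        uncovered  : ∀ {x} → Adj G u x → ¬ Adj F x w

    load≡0⇒free : ∀ {w} → load w ≡ 0 → Free w
    load≡0⇒free {w} eq = record
      { ≢v = λ { refl → <⇒≢ (s≤s z≤n) (sym (trans (sym (δ-refl v)) (m+n≡0⇒m≡0 _ eq))) }
      ; nonadj = ind-zero (m+n≡0⇒m≡0 _ (m+n≡0⇒n≡0 (δ v w) eq))
      ; uncovered = λ p q → <⇒≱ (covered⇒load p q)
          (≤-reflexive (m+n≡0⇒n≡0 (ind (adj G v w)) (m+n≡0⇒n≡0 (δ v w) eq)))
      }

    -- The equality case of the count: `heavy` and `light` express zero slack, `covered` that no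
    -- vertex is unloaded, and `unique`, `free-v` and `free-B` that no vertex other than `u` is
    -- loaded twice.
    record Tight : Set where
      field
        deg-u   : D ≤ deg G u
        deg-v   : D ≤ deg G v
        heavy   : ∀ {x} → Adj G u x → 2 ≤ deg F x
        light   : ∀ {x} → ¬ Adj G u x → deg F x ≤ 2
        covered : ∀ {w} → w ≢ v → ¬ Adj G v w → ∃ λ x → Adj G u x × Adj F x w
        unique  : ∀ {x y w} → w ≢ u → x ≢ y → Adj G u x → Adj G u y → Adj F x w → ¬ Adj F y w
        free-v  : ∀ {x} → v ≢ u → Adj G u x → ¬ Adj F x v
        free-B  : ∀ {x w} → w ≢ u → Adj G v w → Adj G u x → ¬ Adj F x w

    module _ (b : Bounded G) (uv : Adj G u v) (l : Leaf F u v) (loaded : ∀ w → 1 ≤ load w) where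

      private
        sum≥ : suc n ≤ sum load
        sum≥ = n<sum load loaded (load-leaf uv l)

        slack≡0 : ∀ x → slack x ≡ 0
        slack≡0 x = n≤0⇒n≡0 (≤-trans (term≤sum slack x)
          (+-cancelˡ-≤ (sum load) _ _ (≤-trans (load-total≤ b)
            (≤-trans sum≥ (≤-reflexive (sym (+-identityʳ _)))))))

        load≤1 : ∀ {w} → w ≢ u → 2 ≤ load w → ⊥
        load≤1 w≢u p = <⇒≱ (1+n<sum load (≢-sym w≢u) loaded (load-leaf uv l) p)
          (≤-trans (m≤m+n _ _) (load-total≤ b))

        degrees : n ≤ deg G v + (2 * deg G u + excessLeaves F)
        degrees = ≤-pred (≤-trans (≤-trans sum≥ (m≤m+n _ _)) (≤-reflexive load-total))

        degrees-tight : 3 * D + excessLeaves F ≤ deg G v + (2 * deg G u + excessLeaves F)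
        degrees-tight = ≤-trans bound degrees

        degrees-tight′ : D + 2 * D ≤ deg G v + 2 * deg G u
        degrees-tight′ = +-cancelʳ-≤ (excessLeaves F) _ _
          (≤-trans degrees-tight (≤-reflexive (sym (+-assoc (deg G v) _ _))))

      -- If every vertex is loaded, the loads already add up to `suc n`, the upper bound for loads
      -- and slacks together. Nothing is left for slack, for a degree below `D`, or for a second
      -- vertex of load two.
      tight : Tight
      tight = record
        { deg-u = *-cancelˡ-≤ 2 (+-cancelˡ-≤ D _ _
            (≤-trans degrees-tight′ (+-monoˡ-≤ (2 * deg G u) (b v))))
        ; deg-v = +-cancelʳ-≤ (2 * D) _ _
            (≤-trans degrees-tight′ (+-monoʳ-≤ (deg G v) (*-monoʳ-≤ 2 (b u))))
        ; heavy = heavy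
        ; light = light
        ; covered = covered
        ; unique = λ {x} {y} {w} w≢u x≢y ux uy xw yw → load≤1 w≢u
            (≤-trans (two≤sum (λ x → covers x w) x≢y (one ux xw) (one uy yw))
              (≤-trans (m≤n+m _ (ind (adj G v w))) (m≤n+m _ (δ v w))))
        ; free-v = λ v≢u ux xv → load≤1 v≢u (+-mono-≤ (≤-reflexive (sym (δ-refl v)))
            (≤-trans (covered⇒load ux xv) (m≤n+m _ (ind (adj G v v)))))
        ; free-B = λ {x} {w} w≢u vw ux xw → load≤1 w≢u (≤-trans
            (+-mono-≤ (≤-reflexive (sym (ind-true vw))) (covered⇒load ux xw)) (m≤n+m _ (δ v w)))
        }
        where
        one : ∀ {x w} → Adj G u x → Adj F x w → 1 ≤ covers x w
        one p q = ≤-reflexive (sym (cong₂ _*_ (ind-true p) (ind-true q)))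
        heavy : ∀ {x} → Adj G u x → 2 ≤ deg F x
        heavy {x} p with adj G u x | slack≡0 x
        heavy {x} refl | true | eq = m∸n≡0⇒m≤n eq
        light : ∀ {x} → ¬ Adj G u x → deg F x ≤ 2
        light {x} ¬p with adj G u x | slack≡0 x
        ... | true | _   = ⊥-elim (¬p refl)
        ... | false | eq = m∸n≡0⇒m≤n eq
        covered : ∀ {w} → w ≢ v → ¬ Adj G v w → ∃ λ x → Adj G u x × Adj F x w
        covered {w} w≢v ¬vw with sum-pos (λ x → covers x w) (subst (1 ≤_)
          (cong₂ (λ a b → a + (b + sum (λ x → covers x w))) (δ-≢ (≢-sym w≢v)) (ind-false ¬vw)) (loaded w))
        ... | x , p with adj? G u x | adj? F x w
        ...   | yes a | yes c = x , a , c
        ...   | no ¬a | _     = ⊥-elim (<⇒≱ p (≤-reflexive (cong (_* ind (adj F x w)) (ind-false ¬a))))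
        ...   | yes _ | no ¬c = ⊥-elim (<⇒≱ p (≤-reflexive
          (trans (cong (ind (adj G u x) *_) (ind-false ¬c)) (*-zeroʳ (ind (adj G u x))))))

  free⊎tight : ∀ {G u v} → Bounded G → Adj G u v → Leaf F u v → ∃ (Free G u v) ⊎ Tight G u v
  free⊎tight {G} {u} {v} b uv l with any? (λ w → load G u v w ℕ.≟ 0)
  ... | yes (w , eq) = inj₁ (w , load≡0⇒free G u v eq)
  ... | no ¬z = inj₂ (tight G u v b uv l λ w → n≢0⇒n>0 (λ eq → ¬z (w , eq)))

  -- A second conflict at v makes enough room to keep a vertex h of large degree where it is.
  free-fixing : ∀ {G u v w h} → Bounded G → Adj G u v → Leaf F u v →
    w ≢ u → Adj G v w → Adj F v w → ¬ Adj G u h → 3 ≤ deg F h →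
    ∃ λ s → s ≢ h × Free G u v s
  free-fixing {G} {u} {v} {w} {h} b uv l w≢u vw fvw ¬uh dh
    -- Adding the slack excludes `h`, whose slack is positive. If the sum had no zero, both `u` and
    -- `w` would contribute at least two, one more than the total allows.
    with any? (λ s → load G u v s + slack G u v s ℕ.≟ 0)
  ... | yes (s , eq) = s , s≢h , load≡0⇒free G u v (m+n≡0⇒m≡0 _ eq)
    where
    s≢h : s ≢ h
    s≢h refl with adj G u s | m+n≡0⇒n≡0 (load G u v s) eq
    ... | true  | _  = ¬uh refl
    ... | false | e = <⇒≱ dh (m∸n≡0⇒m≤n e)
  ... | no ¬z = ⊥-elim (<⇒≱
      (1+n<sum (λ s → load G u v s + slack G u v s) (≢-sym w≢u)
        (λ s → n≢0⇒n>0 (λ eq → ¬z (s , eq)))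
        (≤-trans (load-leaf G u v uv l) (m≤m+n _ _))
        (≤-trans (≤-trans (+-mono-≤ (≤-reflexive (sym (ind-true vw))) (covered⇒load G u v uv fvw))
          (m≤n+m _ (δ v w))) (m≤m+n _ _)))
      (≤-trans (≤-reflexive (∑-distrib-+ (load G u v) (slack G u v))) (load-total≤ G u v b)))

  module _ {G : Graph n} {u v w : Fin n} (l : Leaf F u v) (free : Free G u v w) where

    Survives : Fin n → Fin n → Set
    Survives i j = Adj G i j × (i ≢ u × i ≢ w) × (j ≢ u × j ≢ w)

    -- The only edge of `F` at position `u` goes to `v`, which is not `G`-adjacent to `w`; and no
    -- `F`-neighbour of `w` is `G`-adjacent to `u`. So nothing new arises, and only conflicts
    -- missing `u` and `w` remain.
    exchange-free : ∀ i j → Adj F i j → Adj (exchange u w G) i j → Survives i j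
    exchange-free = exchange-elim F G Survives (λ { (p , q , r) → Adj-sym G p , r , q })
      (λ uw _ → ⊥-elim (Free.≢v free (only l uw)))
      (λ { j _ _ uj wj → ⊥-elim (Free.nonadj free (Adj-sym G (subst (Adj G w) (only l uj) wj))) })
      (λ j _ _ wj uj → ⊥-elim (Free.uncovered free uj (Adj-sym F wj)))
      (λ i j p q r s _ e → e , (p , q) , (r , s))

-- Placements whose conflicts all lie at one vertex

Conflict : ∀ {n} → Fin n → Fin n → Fin n → Fin n → Set
Conflict u v i j = (i ≡ u × j ≡ v) ⊎ (i ≡ v × j ≡ u)

Conflict-sym : ∀ {n} {u v i j : Fin n} → Conflict u v i j → Conflict u v j i
Conflict-sym (inj₁ (p , q)) = inj₂ (q , p)
Conflict-sym (inj₂ (p , q)) = inj₁ (q , p)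

module Stuck {n} (F : Graph n) (D : ℕ) (bound : 3 * D + excessLeaves F ≤ n) where

  open Core F D bound

  module Repair (v h : Fin n) (dh : 3 ≤ deg F h) where

    LeafConflict : Fin n → Fin n → Set
    LeafConflict i j = (i ≡ v × Leaf F j v) ⊎ (j ≡ v × Leaf F i v)

    -- `away` keeps `h` out of the `G`-neighbourhood of every leaf in conflict. As `h` has
    -- `F`-degree at least 3, tightness at such a leaf would contradict `light`.
    record Repairable (G : Graph n) : Set where
      field
        conflicts : ∀ i j → Adj F i j → Adj G i j → LeafConflict i j
        away      : ∀ {w} → Adj F v w → Adj G v w → ¬ Adj G w h
    open Repairable

    count : Graph n → ℕ
    count G = sum (λ w → ind (adj G v w) * ind (adj F v w))

    count-< : ∀ {G G′ : Graph n} {a} → Adj F v a → Adj G v a →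
      (∀ {w} → Adj F v w → Adj G′ v w → Adj G v w × w ≢ a) → count G′ < count G
    count-< {G} {G′} {a} fa ga old = subst (_≤ count G)
      (trans (∑-distrib-+ (δ a) (λ w → ind (adj G′ v w) * ind (adj F v w))) (cong (_+ count G′) (sum-δ a)))
      (sum-mono le)
      where
      both : ∀ {H : Graph n} {w} → Adj H v w → Adj F v w → ind (adj H v w) * ind (adj F v w) ≡ 1
      both p q = cong₂ _*_ (ind-true p) (ind-true q)
      le : ∀ w → δ a w + ind (adj G′ v w) * ind (adj F v w) ≤ ind (adj G v w) * ind (adj F v w)
      le w with adj? G′ v w | adj? F v w
      le w | yes p | yes q with old q p
      ... | r , w≢a = ≤-reflexive (trans (cong₂ _+_ (δ-≢ (≢-sym w≢a)) (both {G′} p q)) (sym (both {G} r q)))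
      le w | no ¬p | _ = ≤-trans (≤-reflexive 
        (trans (cong (λ k → δ a w + k * _) (ind-false ¬p)) (+-identityʳ _))) (δ≤ w)
        where
        δ≤ : ∀ w → δ a w ≤ ind (adj G v w) * ind (adj F v w)
        δ≤ w with a ≟ w
        ... | yes refl = ≤-reflexive (sym (both {G} ga fa))
        ... | no _     = z≤n
      le w | yes _ | no ¬q = ≤-trans (≤-reflexive (cong₂ _+_ (δ-≢ {v = a} {w} λ { refl → ¬q fa })
        (trans (cong (ind (adj G′ v w) *_) (ind-false ¬q)) (*-zeroʳ (ind (adj G′ v w)))))) z≤n

    -- Induction on the number of conflicts at `v`, with `k` as a strict bound. Each exchange
    -- removes the conflict at one leaf and creates none.
    repair : ∀ k G → count G < k → Bounded G → Repairable G → Packs G F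
    repair (suc k) G c<k b r with any? (λ w → adj? F v w ×-dec adj? G v w)
    ... | no none = disjoint⇒packs {G = G} {F} idₚ disjoint
      where
      disjoint : EdgeDisjoint G F
      disjoint i j f g with conflicts r i j f g
      ... | inj₁ (refl , _) = none (j , f , g)
      ... | inj₂ (refl , _) = none (i , Adj-sym F f , Adj-sym G g)
    ... | yes (u , fvu , vu) = split (any? λ w → ¬? (w ≟ u) ×-dec adj? F v w ×-dec adj? G v w)
      where
      l : Leaf F u v
      l with conflicts r v u fvu vu
      ... | inj₁ (_ , l)    = l
      ... | inj₂ (refl , _) = ⊥-elim (Adj⇒≢ F fvu refl)

      h≢u : h ≢ u
      h≢u refl = <⇒≱ dh (≤-trans (deg≤1 F (only l)) (s≤s z≤n))

      split : Dec (∃ λ w → w ≢ u × Adj F v w × Adj G v w) → Packs G F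
      split (no single) with free⊎tight {G} b (Adj-sym G vu) l
      ... | inj₂ t = ⊥-elim (<⇒≱ dh (Tight.light t (away r fvu vu)))
      ... | inj₁ (s , free) = disjoint⇒packs {G = G} {F} (transpose u s) disjoint
        where
        disjoint : EdgeDisjoint (exchange u s G) F
        disjoint i j f g with exchange-free l free i j f g
        ... | g′ , (i≢u , _) , (j≢u , _) with conflicts r i j f g′
        ...   | inj₁ (refl , _) = single (j , j≢u , f , g′)
        ...   | inj₂ (refl , _) = single (i , i≢u , Adj-sym F f , Adj-sym G g′)
      split (yes (w , w≢u , fvw , vw))
        -- Since `s` differs from `h`, the exchange leaves `h` in place and `away` carries over.
        with free-fixing {G} b (Adj-sym G vu) l w≢u vw fvw (away r fvu vu) dh
      ... | s , s≢h , free = packs-relabel {G = G} {F} (transpose u s)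
        (repair k (exchange u s G)
          (≤-trans (count-< {G} {exchange u s G} fvu vu λ {w} f g →
              let g′ , _ , (w≢u , _) = exchange-free l free v w f g in g′ , w≢u)
            (≤-pred c<k))
          (relabel-bounded G (transpose u s) b)
          record
            { conflicts = λ i j f g → conflicts r i j f (proj₁ (exchange-free l free i j f g))
            ; away = λ {w} f g wh → let g′ , _ , (w≢u , w≢s) = exchange-free l free v w f g in
                away r f g′ (subst₂ (Adj G) (transpose-other w≢u w≢s) (transpose-other h≢u (≢-sym s≢h)) wh)
            })

  OnlyConflict : Graph n → Fin n → Fin n → Set
  OnlyConflict G u v = ∀ i j → Adj F i j → Adj G i j → Conflict u v i j

  -- `OnlyConflict` leaves open whether `uv` is a conflict at all. If it is not, the placement is a
  -- packing; if it is and some vertex is free, one exchange gives a packing.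
  stuck⇒tight : ∀ {G u v} → ¬ Packs G F → Bounded G → Leaf F u v → OnlyConflict G u v →
    Adj G u v × Tight G u v
  stuck⇒tight {G} {u} {v} np b l st with adj? G u v
  ... | no ¬uv = ⊥-elim (np (disjoint⇒packs {G = G} {F} idₚ disjoint))
    where
    disjoint : EdgeDisjoint G F
    disjoint i j f g with st i j f g
    ... | inj₁ (refl , refl) = ¬uv g
    ... | inj₂ (refl , refl) = ¬uv (Adj-sym G g)
  ... | yes uv with free⊎tight {G} b uv l
  ...   | inj₂ t = uv , t
  ...   | inj₁ (w , free) = ⊥-elim (np (disjoint⇒packs {G = G} {F} (transpose u w) disjoint))
    where
    disjoint : EdgeDisjoint (exchange u w G) F
    disjoint i j f g with exchange-free l free i j f g
    ... | g′ , (i≢u , _) , (j≢u , _) with st i j f g′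
    ...   | inj₁ (i≡u , _) = i≢u i≡u
    ...   | inj₂ (_ , j≡u) = j≢u j≡u

  -- In names below, A = N_G(u) and B = N_G(v).
  module AtLeaf {G u v} (np : ¬ Packs G F) (b : Bounded G) (l : Leaf F u v) (st : OnlyConflict G u v) where

    uv : Adj G u v
    uv = proj₁ (stuck⇒tight {G} np b l st)

    open Tight (proj₂ (stuck⇒tight {G} np b l st)) public

    u≢v : u ≢ v
    u≢v = Adj⇒≢ F (edge l)

    module Neighbour {y} (vy : Adj F v y) (y≢u : y ≢ u) where

      y≢v : y ≢ v
      y≢v = ≢-sym (Adj⇒≢ F vy)

      y∉A : ¬ Adj G u y
      y∉A uy = free-v (≢-sym u≢v) uy (Adj-sym F vy)

      y∉B : ¬ Adj G v y
      y∉B gvy with st _ _ vy gvy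
      ... | inj₁ (v≡u , _) = u≢v (sym v≡u)
      ... | inj₂ (_ , y≡u) = y≢u y≡u

      -- Otherwise `t` and `v`, both in A, would cover `y` twice, against `unique`.
      next∉A : ∀ {t} → Adj F y t → t ≢ v → ¬ Adj G u t
      next∉A yt t≢v ut = unique y≢u t≢v ut uv (Adj-sym F yt) vy

    -- If v has degree 2 then, with y its other neighbour, the path u – v – y … is rerouted
    -- as v – y – u …: neither vy, yu nor any further edge at y placed on u lies in G.
    3≤deg-v : 3 ≤ deg F v
    3≤deg-v with 3 ≤? deg F v
    ... | yes p = p
    ... | no ¬p with another-neighbour F (heavy uv) u
    ...   | y , y≢u , vy = ⊥-elim (np (packs-relabel {G = G} {F} (transpose u y)
              (disjoint⇒packs {G = exchange u y G} {F} (transpose u v) disjoint)))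
      where
      open Neighbour vy y≢u
      -- Says that the pair meets {u, v}. Every conflict left by the first exchange does, so the
      -- second needs checking only at `u` and `v`.
      Avoids : Fin n → Fin n → Set
      Avoids i j = ¬ ((i ≢ u × i ≢ v) × (j ≢ u × j ≢ v))
      rest : ∀ i j → Adj F i j → Adj (exchange u y G) i j → Avoids i j
      rest = exchange-elim F G Avoids (λ p (q , r) → p (r , q))
        (λ _ _ ((u≢u , _) , _) → u≢u refl)
        (λ _ _ _ _ _ ((u≢u , _) , _) → u≢u refl)
        (λ j _ _ yj uj (_ , (_ , j≢v)) → next∉A yj j≢v uj)
        (λ i j _ _ _ _ f g ((i≢u , i≢v) , _) → outer i≢u i≢v (st i j f g))
        where
        outer : ∀ {i j} → i ≢ u → i ≢ v → ¬ Conflict u v i j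
        outer i≢u _ (inj₁ (i≡u , _)) = i≢u i≡u
        outer _ i≢v (inj₂ (i≡v , _)) = i≢v i≡v
      disjoint : EdgeDisjoint (exchange u v (exchange u y G)) F
      disjoint = exchange-elim F (exchange u y G) (λ _ _ → ⊥) id
        (λ _ g → y∉B (subst₂ (Adj G) (transpose-other (≢-sym u≢v) (≢-sym y≢v)) (transpose-left u y) g))
        (λ j _ j≢v uj _ → j≢v (only l uj))
        (λ j j≢u _ vj g → at-v j j≢u vj g (j ≟ y))
        (λ i j p q r s f g → rest i j f g ((p , q) , (r , s)))
        where
        at-v : ∀ j → j ≢ u → Adj F v j → Adj (exchange u y G) u j → Dec (j ≡ y) → ⊥
        at-v j _ _ g (yes refl) = y∉A
           (Adj-sym G (subst₂ (Adj G) (transpose-left u y) (transpose-right u y) g))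
        at-v j j≢u vj g (no j≢y) = ¬p
          (deg≥3 F (≢-sym y≢u) (≢-sym j≢u) (≢-sym j≢y) (Adj-sym F (edge l)) vy vj)

    module ExchangeB {z} (vz : Adj G v z) (z≢u : z ≢ u) where

      -- The vertex `z` now at position `u` is again adjacent to `v`, and `free-B` prevents
      -- conflicts at position `z`. Tightness therefore holds with N_G(z) in the role of A.
      still : OnlyConflict (exchange u z G) u v
      still = exchange-elim F G (Conflict u v) Conflict-sym
        (λ uz _ → ⊥-elim (Adj⇒≢ G vz (sym (only l uz))))
        (λ j _ _ uj _ → inj₁ (refl , only l uj))
        (λ j _ _ zj uj → ⊥-elim (free-B z≢u vz uj (Adj-sym F zj)))
        (λ i j _ _ _ _ → st i j)

      private
        tight′ : Tight (exchange u z G) u v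
        tight′ = proj₂ (stuck⇒tight {exchange u z G} (np ∘ packs-relabel {G = G} {F} (transpose u z))
                   (relabel-bounded G (transpose u z) b) l still)

        to′ : ∀ {x} → x ≢ u → x ≢ z → Adj G z x → Adj (exchange u z G) u x
        to′ x≢u x≢z = subst₂ (Adj G) (sym (transpose-left u z)) (sym (transpose-other x≢u x≢z))

      -- This is `light` for the exchanged placement: a hub must lie in the neighbourhood of
      -- whichever vertex occupies position `u`.
      adjacent : ∀ {h} → h ≢ u → h ≢ z → 3 ≤ deg F h → Adj G z h
      adjacent {h} h≢u h≢z dh with adj? G z h
      ... | yes p = p
      ... | no ¬p = ⊥-elim (<⇒≱ dh (Tight.light tight′
              (¬p ∘ subst₂ (Adj G) (transpose-left u z) (transpose-other h≢u h≢z))))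

      unique′ : ∀ {x y w} → w ≢ u → x ≢ y → x ≢ u → x ≢ z → y ≢ u → y ≢ z →
                Adj G z x → Adj G z y → Adj F x w → ¬ Adj F y w
      unique′ w≢u x≢y x≢u x≢z y≢u y≢z zx zy =
        Tight.unique tight′ w≢u x≢y (to′ x≢u x≢z zx) (to′ y≢u y≢z zy)

    module SecondHub {h u′} (h≢v : h ≢ v) (dh : 3 ≤ deg F h) (l′ : Leaf F u′ h) where

      uh : Adj G u h
      uh with adj? G u h
      ... | yes p = p
      ... | no ¬p = ⊥-elim (<⇒≱ dh (light ¬p))

      h≢u : h ≢ u
      h≢u = ≢-sym (Adj⇒≢ G uh)

      u′≢u : u′ ≢ u
      u′≢u refl = h≢v (only l (edge l′))

      u′∉A : ¬ Adj G u u′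
      u′∉A p = <⇒≱ (heavy p) (deg≤1 F (only l′))

      u′∉B : ¬ Adj G v u′
      u′∉B p = free-B u′≢u p uh (Adj-sym F (edge l′))

      u′≢v : u′ ≢ v
      u′≢v refl = u′∉A uv

      -- Otherwise u and u′ can trade places, after which u′h is the only conflict,
      -- and h would be both adjacent and not adjacent in F to the neighbourhood of u in G.
      vh : Adj G v h
      vh with adj? G v h
      ... | yes p = p
      ... | no ¬p with covered h≢v ¬p
      ...   | x , ux , xh = ⊥-elim (Tight.free-v
                (proj₂ (stuck⇒tight {exchange u u′ G} (np ∘ packs-relabel {G = G} {F} (transpose u u′))
                  (relabel-bounded G (transpose u u′) b) l′ swapped))
                (≢-sym (Adj⇒≢ F (edge l′)))
                (subst₂ (Adj G) (sym (transpose-right u u′))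
                  (sym (transpose-other (≢-sym (Adj⇒≢ G ux)) (Adj-≢ G ux u′∉A))) ux)
                xh)
        where
        outer : ∀ {i j} → i ≢ u → j ≢ u → ¬ Conflict u v i j
        outer i≢u _ (inj₁ (i≡u , _)) = i≢u i≡u
        outer _ j≢u (inj₂ (_ , j≡u)) = j≢u j≡u
        swapped : OnlyConflict (exchange u u′ G) u′ h
        swapped = exchange-elim F G (Conflict u′ h) Conflict-sym
          (λ uu′ _ → ⊥-elim (u′≢v (only l uu′)))
          (λ { j _ _ uj u′j → ⊥-elim (u′∉B (Adj-sym G (subst (Adj G u′) (only l uj) u′j))) })
          (λ j _ _ u′j _ → inj₁ (refl , only l′ u′j))
          (λ i j i≢u _ j≢u _ f g → ⊥-elim (outer i≢u j≢u (st i j f g)))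

      -- `u` is adjacent to the hub by `uh`, and every other vertex of B can take the place of `u`.
      B⊆N[h] : ∀ {z} → Adj G v z → z ≢ h → Adj G h z
      B⊆N[h] {z} vz z≢h with z ≟ u
      ... | yes refl = Adj-sym G uh
      ... | no z≢u   = Adj-sym G (ExchangeB.adjacent vz z≢u h≢u (≢-sym z≢h) dh)

      -- The closed neighbourhood of `v` has at least D + 1 elements and is contained in that of
      -- `h`, which has at most D + 1. A further neighbour `w` of `h` would be one too many.
      N[h]⊆N[v] : ∀ {w} → w ≢ v → ¬ Adj G v w → ¬ Adj G h w
      N[h]⊆N[v] {w} w≢v ¬vw hw = 1+n≰n (≤-trans total
        (≤-trans (+-monoˡ-≤ 1 (≤-trans (b h) deg-v)) (≤-reflexive (+-comm _ 1))))
        where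
        lhs rhs : Fin n → ℕ
        lhs x = δ v x + (δ w x + ind (adj G v x))
        rhs x = ind (adj G h x) + δ h x
        le : ∀ x → lhs x ≤ rhs x
        le x with v ≟ x | w ≟ x
        ... | yes refl | yes refl = ⊥-elim (w≢v refl)
        ... | yes refl | no _ = ≤-trans (≤-reflexive (trans (cong suc (ind-false λ p → Adj⇒≢ G p refl))
                (sym (ind-true (Adj-sym G vh))))) (m≤m+n _ _)
        ... | no _ | yes refl = ≤-trans (≤-reflexive (trans (cong suc (ind-false ¬vw))
                (sym (ind-true hw)))) (m≤m+n _ _)
        ... | no _ | no _ with adj? G v x | h ≟ x
        ...   | no ¬p | _ = subst (_≤ _) (sym (ind-false ¬p)) z≤n
        ...   | yes p | yes refl = ≤-trans (≤-reflexive (ind-true p)) (m≤n+m _ _)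
        ...   | yes p | no h≢x = ≤-trans (≤-reflexive (trans (ind-true p)
                (sym (ind-true (B⊆N[h] p (≢-sym h≢x)))))) (m≤m+n _ _)
        total : suc (suc (deg G v)) ≤ deg G h + 1
        total = subst₂ _≤_
          (trans (∑-distrib-+ (δ v) (λ x → δ w x + ind (adj G v x))) (cong₂ _+_ (sum-δ v)
            (trans (∑-distrib-+ (δ w) (λ x → ind (adj G v x))) (cong₂ _+_ (sum-δ w) (sym (deg≡sum G v))))))
          (trans (∑-distrib-+ (λ x → ind (adj G h x)) (δ h)) (cong₂ _+_ (sym (deg≡sum G h)) (sum-δ h)))
          (sum-mono le)

      -- Move v to the place of y, the only neighbour of v in F that may fail to be a leaf.
      impossible : ∀ {y} → Adj F v y → y ≢ u → (∀ {w} → Adj F v w → w ≢ y → Leaf F w v) → ⊥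
      impossible {y} vy y≢u leaves = np (packs-relabel {G = G} {F} (transpose v y)
        (Repair.repair v h dh _ (exchange v y G) ≤-refl (relabel-bounded G (transpose v y) b)
          record { conflicts = conflicts ; away = away }))
        where
        open Neighbour vy y≢u
        open Repair v h dh using (LeafConflict)
        h≢y : h ≢ y
        h≢y = Adj-≢ G uh y∉A
        -- A vertex `t` of B is adjacent to `h`, as is `v`. Once `u` and `h` have traded places,
        -- both `t` and `v` would cover `y`.
        next∉B : ∀ {t} → Adj F y t → t ≢ v → ¬ Adj G v t
        next∉B {t} yt t≢v vt = ExchangeB.unique′ vh h≢u y≢u t≢v t≢u t≢h (≢-sym u≢v) (≢-sym h≢v)
          (B⊆N[h] vt t≢h) (Adj-sym G vh) (Adj-sym F yt) vy
          where
          t≢u : t ≢ u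
          t≢u refl = y≢v (only l (Adj-sym F yt))
          t≢h : t ≢ h
          t≢h refl = next∉A yt h≢v uh
        conflicts : ∀ i j → Adj F i j → Adj (exchange v y G) i j → LeafConflict i j
        conflicts = exchange-elim F G LeafConflict
          (λ { (inj₁ p) → inj₂ p ; (inj₂ p) → inj₁ p })
          (λ _ yv → ⊥-elim (y∉B (Adj-sym G yv)))
          (λ j _ j≢y vj _ → inj₁ (refl , leaves vj j≢y))
          (λ j j≢v _ yj vj → ⊥-elim (next∉B yj j≢v vj))
          (λ i j i≢v _ j≢v _ f g → ⊥-elim (outer i≢v j≢v (st i j f g)))
          where
          outer : ∀ {i j} → i ≢ v → j ≢ v → ¬ Conflict u v i j
          outer _ j≢v (inj₁ (_ , j≡v)) = j≢v j≡v
          outer i≢v _ (inj₂ (i≡v , _)) = i≢v i≡v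
        -- `y` is adjacent to neither `v` nor `u`, so `w` is another leaf at `v`. It was no conflict
        -- before the move, hence lies outside N_G[v] and is not adjacent to the twin `h`.
        away : ∀ {w} → Adj F v w → Adj (exchange v y G) v w → ¬ Adj (exchange v y G) w h
        away {w} fvw g wh = by (w ≟ y) (w ≟ u)
          where
          w≢v : w ≢ v
          w≢v = ≢-sym (Adj⇒≢ F fvw)
          by : Dec (w ≡ y) → Dec (w ≡ u) → ⊥
          by (yes refl) _ = y∉B (Adj-sym G (subst₂ (Adj G) (transpose-left v y) (transpose-right v y) g))
          by (no w≢y) (yes refl) = y∉A
            (Adj-sym G (subst₂ (Adj G) (transpose-left v y) (transpose-other w≢v w≢y) g))
          by (no w≢y) (no w≢u) = N[h]⊆N[v] w≢v (Neighbour.y∉B fvw w≢u)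
            (Adj-sym G (subst₂ (Adj G) (transpose-other w≢v w≢y) (transpose-other h≢v h≢y) wh))

-- Longest paths in a forest

Path : ∀ {n} → Graph n → List (Fin n) → Set
Path G p = Walk G p × Unique p

walk? : ∀ {n} (G : Graph n) p → Dec (Walk G p)
walk? G []          = yes tt
walk? G (x ∷ [])    = yes tt
walk? G (x ∷ y ∷ p) = adj? G x y ×-dec walk? G (y ∷ p)

path? : ∀ {n} (G : Graph n) p → Dec (Path G p)
path? G p = walk? G p ×-dec unique? _≟_ p

unique-lookup : ∀ {A : Set} {xs : List A} → Unique xs →
  ∀ {i j} → List.lookup xs i ≡ List.lookup xs j → i ≡ j
unique-lookup (_ ∷ _)  {zero}  {zero}  _  = refl
unique-lookup (a ∷ _)  {zero}  {suc j} eq = ⊥-elim (All.lookup a (∈-lookup j) eq)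
unique-lookup (a ∷ _)  {suc i} {zero}  eq = ⊥-elim (All.lookup a (∈-lookup i) (sym eq))
unique-lookup (_ ∷ us) {suc i} {suc j} eq = cong suc (unique-lookup us eq)

unique-length : ∀ {n} {xs : List (Fin n)} → Unique xs → length xs ≤ n
unique-length us = injective⇒≤ (unique-lookup us)

Longest : ∀ {n} → Graph n → List (Fin n) → Set
Longest G p = Path G p × (∀ {q} → Path G q → length q ≤ length p)

-- Distinctness bounds the length by `n`; the search descends from there, testing all vectors of
-- each length.
longest-exists : ∀ {n} (G : Graph n) → ∃ (Longest G)
longest-exists {n} G = search n (unique-length ∘ proj₂)
  where
  search : ∀ m → (∀ {q} → Path G q → length q ≤ m) → ∃ (Longest G)
  search zero    bnd = [] , (tt , []) , bnd
  search (suc m) bnd with anyVec? {k = suc m} (λ v → path? G (toList v))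
  ... | yes (v , p) = toList v , p , λ q → ≤-trans (bnd q) (≤-reflexive (sym (length-toList v)))
  ... | no none = search m λ {q} p → ≤-pred (≤∧≢⇒< (bnd p) λ eq → none (has q p eq))
    where
    has : ∀ q → Path G q → length q ≡ suc m → ∃ λ (v : Vec (Fin n) (suc m)) → Path G (toList v)
    has q p eq = subst (λ k → ∃ λ (v : Vec (Fin n) k) → Path G (toList v)) eq
      (fromList q , subst (Path G) (sym (toList∘fromList q)) p)

walk-ʳ++ : ∀ {n} (G : Graph n) xs {a acc} → Walk G (a ∷ xs) → Walk G (a ∷ acc) → Walk G (xs ʳ++ (a ∷ acc))
walk-ʳ++ G []       _       w = w
walk-ʳ++ G (b ∷ xs) (e , w) v = walk-ʳ++ G xs w (Adj-sym G e , v)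

walk-reverse : ∀ {n} (G : Graph n) xs → Walk G xs → Walk G (reverse xs)
walk-reverse G []       _ = tt
walk-reverse G (x ∷ xs) w = walk-ʳ++ G xs w tt

longest-reverse : ∀ {n} {G : Graph n} {p} → Longest G p → Longest G (reverse p)
longest-reverse {n} {G} {p} ((w , u) , max) =
  (walk-reverse G p w , PermSetoid.Unique-resp-↭ (setoid (Fin n)) (↭⇒↭ₛ (↭-sym (↭-reverse p))) u) ,
  λ q → ≤-trans (max q) (≤-reflexive (sym (length-reverse p)))

module _ {A : Set} {c : A} where

  -- The initial segment up to and including the given occurrence of `c`; an edge from `c` back to
  -- the start will close it to a cycle.
  upTo∈ : ∀ {xs} → c ∈ xs → List A
  upTo∈ {x ∷ _} (here _)  = x ∷ []
  upTo∈ {x ∷ _} (there p) = x ∷ upTo∈ p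

  upTo∈-all : ∀ {P : A → Set} {xs} (p : c ∈ xs) → All P xs → All P (upTo∈ p)
  upTo∈-all (here _)  (px ∷ _)  = px ∷ []
  upTo∈-all (there p) (px ∷ ps) = px ∷ upTo∈-all p ps

  upTo∈-unique : ∀ {xs} (p : c ∈ xs) → Unique xs → Unique (upTo∈ p)
  upTo∈-unique (here _)  _        = [] ∷ []
  upTo∈-unique (there p) (a ∷ us) = upTo∈-all p a ∷ upTo∈-unique p us

  upTo∈-last : ∀ {a xs} (p : c ∈ xs) → lastOf a (upTo∈ p) ≡ c
  upTo∈-last (here refl) = refl
  upTo∈-last (there p)   = upTo∈-last p

  upTo∈-nonempty : ∀ {xs} (p : c ∈ xs) → 1 ≤ length (upTo∈ p)
  upTo∈-nonempty (here _)  = s≤s z≤n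
  upTo∈-nonempty (there p) = s≤s z≤n

upTo∈-walk : ∀ {n} (G : Graph n) {a c xs} (p : c ∈ xs) → Walk G (a ∷ xs) → Walk G (a ∷ upTo∈ p)
upTo∈-walk G (here _)  (e , _) = e , tt
upTo∈-walk G (there p) (e , w) = e , upTo∈-walk G p w

module Forest {n} (F : Graph n) (forest : IsForest F) where

  -- If `c` occurred later on the path, the segment from `a` to `c` and the edge `ac` would form a
  -- cycle.
  extend : ∀ {a b r c} → Path F (a ∷ b ∷ r) → Adj F a c → c ≢ b → Path F (c ∷ a ∷ b ∷ r)
  extend {a} {b} {r} {c} ((e , w) , u@((a≢b ∷ a∉) ∷ (b∉ ∷ ur))) ac c≢b =
    (Adj-sym F ac , e , w) , ¬Any⇒All¬ _ fresh ∷ u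
    where
    fresh : c ∉ a ∷ b ∷ r
    fresh (here refl)         = Adj⇒≢ F ac refl
    fresh (there (here refl)) = c≢b refl
    fresh (there (there p))   = forest (a ∷ b ∷ upTo∈ p)
      ( (a≢b ∷ upTo∈-all p a∉) ∷ upTo∈-all p b∉ ∷ upTo∈-unique p ur
      , s≤s (s≤s (upTo∈-nonempty p))
      , (e , upTo∈-walk F p w)
      , subst (λ x → Adj F x a) (sym (upTo∈-last p)) (Adj-sym F ac))

  no-triangle : ∀ {a b c} → Adj F a b → Adj F b c → ¬ Adj F c a
  no-triangle {a} {b} {c} ab bc ca = forest (a ∷ b ∷ c ∷ [])
    ( (Adj⇒≢ F ab ∷ ≢-sym (Adj⇒≢ F ca) ∷ []) ∷ (Adj⇒≢ F bc ∷ []) ∷ [] ∷ []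
    , s≤s (s≤s (s≤s z≤n)) , (ab , bc , tt) , ca)

  longest-front : ∀ {a b r} → Longest F (a ∷ b ∷ r) → Leaf F a b
  longest-front {a} {b} {r} (p@((ab , _) , _) , max) = leaf ab only′
    where
    only′ : ∀ {w} → Adj F a w → w ≡ b
    only′ {w} aw with w ≟ b
    ... | yes w≡b = w≡b
    ... | no w≢b  = ⊥-elim (1+n≰n (max (extend p aw w≢b)))

  -- Replacing the first vertex by `w` gives a path of the same length, whose front is a leaf for
  -- the same reason.
  longest-second : ∀ {a b d r w} → Longest F (a ∷ b ∷ d ∷ r) → Adj F b w → w ≢ d → Leaf F w b
  longest-second (((_ , w) , (_ ∷ us)) , max) bw w≢d = longest-front (extend (w , us) bw w≢d , max)

  private
    ʳ++-front : ∀ {A : Set} {v : A} xs {a b acc} → v ∈ acc →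
      ∃ λ z → ∃ λ z′ → ∃ λ r → xs ʳ++ (a ∷ b ∷ acc) ≡ z ∷ z′ ∷ r × v ∈ r
    ʳ++-front []       v∈ = _ , _ , _ , refl , v∈
    ʳ++-front (x ∷ xs) v∈ = ʳ++-front xs (there v∈)

  -- On a path with at least four vertices the far end is a leaf whose neighbour is not `v`. If a
  -- longest path has three vertices, `x` with two of its neighbours is another one, so `x` itself
  -- carries a leaf.
  another-hub : ∀ {u v y r x} → Longest F (u ∷ v ∷ y ∷ r) → x ≢ v → 2 ≤ deg F x →
    ∃ λ h → ∃ λ u′ → h ≢ v × Leaf F u′ h
  another-hub {r = []} {x} (_ , max) x≢v dx with neighbour F (≤-trans (s≤s z≤n) dx)
  ... | q , xq with another-neighbour F dx q
  ...   | p , p≢q , xp = x , p , x≢v , longest-front {r = q ∷ []}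
          (((Adj-sym F xp , xq , tt) ,
            (≢-sym (Adj⇒≢ F xp) ∷ p≢q ∷ []) ∷ (Adj⇒≢ F xq ∷ []) ∷ [] ∷ []) , max)
  another-hub {u} {v} {y} {a ∷ r} long _ _ with ʳ++-front r {a} {y} {v ∷ u ∷ []} (here refl)
  ... | z , z′ , r′ , eq , v∈ with subst (Longest F) eq (longest-reverse long)
  ...   | long′@((_ , _ ∷ (z′∉ ∷ _)) , _) = z′ , z , All.lookup z′∉ v∈ , longest-front long′

-- Deleting an edge

module _ {n} (F : Graph n) (u v : Fin n) where

  conflict? : ∀ i j → Dec (Conflict u v i j)
  conflict? i j = (i ≟ u ×-dec j ≟ v) ⊎-dec (i ≟ v ×-dec j ≟ u)

  delete : Graph n
  delete .adj i j = adj F i j ∧ not (does (conflict? i j))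
  delete .Graph.sym i j = cong₂ (λ p q → p ∧ not q) (Graph.sym F i j)
    (does-⇔ (mk⇔ Conflict-sym Conflict-sym) (conflict? i j) (conflict? j i))
  delete .irrefl i = cong (_∧ not (does (conflict? i i))) (Graph.irrefl F i)

  delete⊆ : ∀ i j → Adj delete i j → Adj F i j
  delete⊆ i j p with adj F i j
  ... | true = refl

  delete-split : ∀ i j → Adj F i j → Adj delete i j ⊎ Conflict u v i j
  delete-split i j p with conflict? i j
  ... | yes c = inj₂ c
  ... | no ¬c = inj₁ (trans (cong (λ b → adj F i j ∧ not b) (dec-false (conflict? i j) ¬c))
                  (trans (Bool.∧-identityʳ _) p))

  delete-edge : ¬ Adj delete u v
  delete-edge p with trans (sym p) (trans
    (cong (λ b → adj F u v ∧ not b) (dec-true (conflict? u v) (inj₁ (refl , refl)))) (Bool.∧-zeroʳ _))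
  ... | ()

  delete-forest : IsForest F → IsForest delete
  delete-forest forest (x ∷ xs) (uniq , len , w , e) =
    forest (x ∷ xs) (uniq , len , walk (x ∷ xs) w , delete⊆ _ _ e)
    where
    walk : ∀ xs → Walk delete xs → Walk F xs
    walk []           _       = tt
    walk (x ∷ [])     _       = tt
    walk (x ∷ y ∷ xs) (e , w) = delete⊆ x y e , walk (y ∷ xs) w

  private
    ind≤ : ∀ i j → ind (adj delete i j) ≤ ind (adj F i j)
    ind≤ i j with adj F i j | not (does (conflict? i j))
    ... | false | _     = z≤n
    ... | true  | false = z≤n
    ... | true  | true  = ≤-refl

  delete-deg : ∀ x → deg delete x ≤ deg F x
  delete-deg x = subst₂ _≤_ (sym (deg≡sum delete x)) (sym (deg≡sum F x)) (sum-mono (ind≤ x))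

  delete-excess : excessLeaves delete ≤ excessLeaves F
  delete-excess = subst₂ _≤_
    (sym (listSum≡sum (λ x → deg delete x ∸ 2))) (sym (listSum≡sum (λ x → deg F x ∸ 2)))
    (sum-mono λ x → ∸-monoˡ-≤ 2 (delete-deg x))

  delete-size : Adj F u v → sum (deg delete) < sum (deg F)
  delete-size uv = sum-mono-< u delete-deg
    (subst₂ _<_ (sym (deg≡sum delete u)) (sym (deg≡sum F u))
      (sum-mono-< v (ind≤ u) (subst₂ _<_ (sym (ind-false delete-edge)) (sym (ind-true uv)) (s≤s z≤n))))
    where
    sum-mono-< : ∀ {m} {f g : Fin m → ℕ} a → (∀ i → f i ≤ g i) → f a < g a → sum f < sum g
    sum-mono-< zero    f≤g fa<ga = +-mono-<-≤ fa<ga (sum-mono (f≤g ∘ suc))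
    sum-mono-< (suc a) f≤g fa<ga = +-mono-≤-< (f≤g zero) (sum-mono-< a (f≤g ∘ suc) fa<ga)

-- The exceptional pair

-- In a forest this determines all adjacencies, since an edge between two other vertices would close
-- a triangle with the centre.
IsStar : ∀ {n} → Graph n → Set
IsStar F = ∃ λ c → ∀ {w} → w ≢ c → Adj F c w

IsPerfectMatching : ∀ {n} → Graph n → Set
IsPerfectMatching G = ∀ x → ∃ (Leaf G x)

perfect-relabel : ∀ {n} {G : Graph n} π → IsPerfectMatching (relabel π G) → IsPerfectMatching G
perfect-relabel {G = G} π m x with m (π ⟨$⟩ˡ x)
... | y , l = π ⟨$⟩ʳ y , leaf (subst (λ a → Adj G a (π ⟨$⟩ʳ y)) (inverseʳ π) (edge l))
  λ {w} xw → trans (sym (inverseʳ π)) (cong (π ⟨$⟩ʳ_) (only l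
    (subst₂ (Adj G) (sym (inverseʳ π)) (sym (inverseʳ π)) xw)))

perfect-relabel⁻ : ∀ {n} {G : Graph n} π → IsPerfectMatching G → IsPerfectMatching (relabel π G)
perfect-relabel⁻ {G = G} π m x with m (π ⟨$⟩ʳ x)
... | y , l = π ⟨$⟩ˡ y , leaf (subst (Adj G (π ⟨$⟩ʳ x)) (sym (inverseʳ π)) (edge l))
  λ {w} xw → trans (sym (inverseˡ π)) (cong (π ⟨$⟩ˡ_) (only l xw))

-- Induction on the number of edges of the forest

stuck⇒exceptional : ∀ k {n} (F : Graph n) → sum (deg F) < k → IsForest F →
  ∀ D (G : Graph n) → 3 * D + excessLeaves F ≤ n → (∀ v → deg G v ≤ D) →
  ¬ Packs G F → IsStar F × IsPerfectMatching G
stuck⇒exceptional (suc k) {n} F size forest D G bound b np = cases (longest-exists F)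
  where
  open Core F D bound using (Bounded; relabel-bounded)
  open Stuck F D bound
  open Forest F forest

  -- Deleting `uv` isolates `u`, so the smaller forest is not a star and packs with `G` by
  -- induction. Restoring the edge creates at most the conflict `uv`.
  placement : ∀ {u v} → Leaf F u v → ∃ λ π → OnlyConflict (relabel π G) u v
  placement {u} {v} l with packs? G (delete F u v)
  ... | yes p with packs⇒disjoint {G = G} {delete F u v} p
  ...   | π , disj = π , λ i j f g → conflict (delete-split F u v i j f) (λ e → disj i j e g)
    where
    conflict : ∀ {i j} → Adj (delete F u v) i j ⊎ Conflict u v i j →
      ¬ Adj (delete F u v) i j → Conflict u v i j
    conflict (inj₁ e) ¬e = ⊥-elim (¬e e)
    conflict (inj₂ c) _  = c
  placement {u} {v} l | no np′ with stuck⇒exceptional k (delete F u v)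
      (≤-trans (delete-size F u v (edge l)) (≤-pred size)) (delete-forest F u v forest) D G
      (≤-trans (+-monoʳ-≤ (3 * D) (delete-excess F u v)) bound) b np′
  ... | (c , star) , _ = ⊥-elim (isolated (u ≟ c))
    where
    isolated : Dec (u ≡ c) → ⊥
    isolated (yes refl) = delete-edge F u v (star (≢-sym (Adj⇒≢ F (edge l))))
    isolated (no u≢c) with only l (Adj-sym F (delete⊆ F u v c u (star u≢c)))
    ... | refl = delete-edge F u v (Adj-sym (delete F u v) (star u≢c))

  module At {u v} (l : Leaf F u v) where
    π = proj₁ (placement l)
    G′ = relabel π G
    np′ : ¬ Packs G′ F
    np′ = np ∘ packs-relabel {G = G} {F} π
    b′ : Bounded G′
    b′ = relabel-bounded G π b
    open AtLeaf {G′} np′ b′ l (proj₂ (placement l)) public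

  hub : ∀ {u v} → Leaf F u v → 3 ≤ deg F v
  hub l = At.3≤deg-v l

  module SmallDegree {u v} (l : Leaf F u v) (lone : ∀ {x} → Adj (At.G′ l) u x → x ≡ v) where

    open At l

    D≤1 : D ≤ 1
    D≤1 = ≤-trans deg-u (deg≤1 G′ lone)

    at-most-one : ∀ {x y z} → Adj G′ x y → Adj G′ x z → z ≡ y
    at-most-one {x} {y} {z} xy xz with z ≟ y
    ... | yes z≡y = z≡y
    ... | no z≢y  = ⊥-elim (<⇒≱ (deg≥2 G′ z≢y xz xy) (≤-trans (b′ x) D≤1))

    -- With `D ≤ 1` the only `G`-neighbour of `v` is `u`. Every other `w` is covered by a member of
    -- A, which can only be `v`.
    star : ∀ {w} → w ≢ v → Adj F v w
    star {w} w≢v with w ≟ u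
    ... | yes refl = Adj-sym F (edge l)
    ... | no w≢u with covered w≢v (w≢u ∘ at-most-one (Adj-sym G′ uv))
    ...   | x , ux , xw = subst (λ x → Adj F x w) (lone ux) xw

    -- If `z` were isolated in `G′`, placing it at the centre `v` would remove all conflicts, as
    -- every edge of the star `F` meets `v`.
    perfect : IsPerfectMatching G′
    perfect z with any? (adj? G′ z)
    ... | yes (y , zy) = y , leaf zy (at-most-one zy)
    ... | no isolated = ⊥-elim (np′ (disjoint⇒packs {G = G′} {F} (transpose v z)
      (exchange-elim F G′ (λ _ _ → ⊥) id
        (λ _ zv → isolated (v , zv))
        (λ j _ _ _ zj → isolated (j , zj))
        (λ j j≢v _ zj _ → no-triangle (star z≢v) zj (Adj-sym F (star j≢v)))
        (λ i j i≢v _ j≢v _ ij _ → no-triangle (star i≢v) ij (Adj-sym F (star j≢v))))))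
      where
      z≢v : z ≢ v
      z≢v refl = isolated (u , Adj-sym G′ uv)

  cases : ∃ (Longest F) → IsStar F × IsPerfectMatching G
  cases ([] , _ , max) = ⊥-elim (np (disjoint⇒packs {G = G} {F} idₚ
    λ i j f _ → <⇒≱ (s≤s z≤n) (max {i ∷ []} (tt , [] ∷ []))))
  cases (a ∷ [] , _ , max) = ⊥-elim (np (disjoint⇒packs {G = G} {F} idₚ
    λ i j f _ → <⇒≱ (s≤s (s≤s z≤n)) (max {i ∷ j ∷ []} ((f , tt) , (Adj⇒≢ F f ∷ []) ∷ [] ∷ []))))
  -- A path on two vertices is not longest here, because `v` is a hub and has a neighbour beyond
  -- `u`.
  cases (u ∷ v ∷ [] , long@(((uv , _) , _) , max))
    with another-neighbour F (<⇒≤ (hub (longest-front long))) u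
  ... | c , c≢u , vc = ⊥-elim (1+n≰n (max (extend {v} {u} {[]}
    ((Adj-sym F uv , tt) , (≢-sym (Adj⇒≢ F uv) ∷ []) ∷ [] ∷ []) vc c≢u)))
  cases (u ∷ v ∷ y ∷ r , long@(((uv , vy , _) , ((_ ∷ u≢y ∷ _) ∷ _)) , _)) =
    split (any? λ x → ¬? (x ≟ v) ×-dec adj? G′ u x)
    where
    l = longest-front long
    open At l
    -- A second `G`-neighbour of `u` is not a leaf of `F` by `heavy` and so yields a second hub;
    -- otherwise A consists of `v` alone.
    split : Dec (∃ λ x → x ≢ v × Adj G′ u x) → IsStar F × IsPerfectMatching G
    split (yes (x , x≢v , ux)) with another-hub long x≢v (heavy ux)
    ... | h , u′ , h≢v , l′ = ⊥-elim
      (SecondHub.impossible h≢v (hub l′) l′ vy (≢-sym u≢y) (longest-second long))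
    split (no none) = (v , star) , perfect-relabel {G = G} π perfect
      where
      lone : ∀ {x} → Adj G′ u x → x ≡ v
      lone {x} ux with x ≟ v
      ... | yes x≡v = x≡v
      ... | no x≢v  = ⊥-elim (none (x , x≢v , ux))
      open SmallDegree l (λ {x} → lone {x})

-- Isomorphisms with the standard star and matching

star-iso : ∀ {n} (F : Graph n) → IsForest F → IsStar F → F ≅ᵃ starAdj
star-iso {suc n} F forest (c , star) = ↔⇒⤖ τ , iso
  where
  τ = transpose c zero
  isZero-≢ : ∀ {x} → x ≢ c → isZero (τ ⟨$⟩ʳ x) ≡ false
  isZero-≢ {x} x≢c with τ ⟨$⟩ʳ x in eq
  ... | suc _ = refl
  ... | zero  = ⊥-elim (x≢c (trans (sym (inverseˡ τ)) (trans (cong (τ ⟨$⟩ˡ_) eq) (transpose-left zero c))))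
  isZero-c : isZero (τ ⟨$⟩ʳ c) ≡ true
  isZero-c = cong isZero (transpose-left c zero)
  table : Bool → Bool → Bool
  table p q = (p ∧ not q) ∨ (q ∧ not p)
  iso : ∀ u v → adj F u v ≡ starAdj (τ ⟨$⟩ʳ u) (τ ⟨$⟩ʳ v)
  iso u v = by (u ≟ c) (v ≟ c)
    where
    by : Dec (u ≡ c) → Dec (v ≡ c) → adj F u v ≡ table (isZero (τ ⟨$⟩ʳ u)) (isZero (τ ⟨$⟩ʳ v))
    by (yes refl) (yes refl) = trans (irrefl F c) (sym (cong₂ table isZero-c isZero-c))
    by (yes refl) (no v≢c)   = trans (star v≢c) (sym (cong₂ table isZero-c (isZero-≢ v≢c)))
    by (no u≢c)   (yes refl) = trans (Adj-sym F (star u≢c)) (sym (cong₂ table (isZero-≢ u≢c) isZero-c))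
    by (no u≢c)   (no v≢c)   = trans
      (Bool.¬-not λ e → Forest.no-triangle F forest (star u≢c) e (Adj-sym F (star v≢c)))
      (sym (cong₂ table (isZero-≢ u≢c) (isZero-≢ v≢c)))

half : ∀ k → suc (suc k) / 2 ≡ suc (k / 2)
half k = m/n≡1+[m∸n]/n {suc (suc k)} {2} (s≤s (s≤s z≤n))

isYes-⇔ : ∀ {A B : Set} (a? : Dec A) (b? : Dec B) → (A → B) → (B → A) → ⌊ a? ⌋ ≡ ⌊ b? ⌋
isYes-⇔ (yes _) (yes _) _ _ = refl
isYes-⇔ (yes a) (no ¬b) f _ = ⊥-elim (¬b (f a))
isYes-⇔ (no ¬a) (yes b) _ g = ⊥-elim (¬a (g b))
isYes-⇔ (no _)  (no _)  _ _ = refl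

matchingAdj-suc : ∀ {n} (i j : Fin n) → matchingAdj (suc (suc i)) (suc (suc j)) ≡ matchingAdj i j
matchingAdj-suc i j = cong₂ (λ p q → p ∧ not q)
  (isYes-⇔ (_ ℕ.≟ _) (_ ℕ.≟ _)
    (λ e → suc-injective (trans (sym (half (toℕ i))) (trans e (half (toℕ j)))))
    (λ e → trans (half (toℕ i)) (trans (cong suc e) (sym (half (toℕ j))))))
  (isYes-⇔ (_ ℕ.≟ _) (_ ℕ.≟ _) (suc-injective ∘ suc-injective) (cong (2 +_)))

matchingAdj-sym : ∀ {n} (i j : Fin n) → matchingAdj i j ≡ matchingAdj j i
matchingAdj-sym i j = cong₂ (λ p q → p ∧ not q)
  (isYes-⇔ (toℕ i / 2 ℕ.≟ toℕ j / 2) (toℕ j / 2 ℕ.≟ toℕ i / 2) sym sym)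
  (isYes-⇔ (toℕ i ℕ.≟ toℕ j) (toℕ j ℕ.≟ toℕ i) sym sym)

-- Induction in steps of two: relabelling puts the partner of vertex 0 at 1, and the remaining
-- vertices again carry a perfect matching.
matching-iso : ∀ n (G : Graph n) → IsPerfectMatching G →
  (2 ∣ n) × (∃ λ (π : Permutation′ n) → ∀ u v → adj G u v ≡ matchingAdj (π ⟨$⟩ʳ u) (π ⟨$⟩ʳ v))
matching-iso zero G m = (2 ∣0) , idₚ , λ ()
matching-iso (suc zero) G m with m zero
... | zero , l = ⊥-elim (Adj⇒≢ G (edge l) refl)
matching-iso (suc (suc n)) G m = ∣m∣n⇒∣m+n ∣-refl (proj₁ IH) , flip τ ∘ₚ lift₀ (lift₀ f) ,
  λ u v → trans (sym (cong₂ (adj G) (inverseʳ τ) (inverseʳ τ))) (iso (τ ⟨$⟩ˡ u) (τ ⟨$⟩ˡ v))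
  where
  0′ 1′ : Fin (suc (suc n))
  0′ = zero
  1′ = suc zero
  partner = proj₁ (m 0′)
  τ : Permutation′ (suc (suc n))
  τ = transpose 1′ partner
  H = relabel τ G
  m′ : IsPerfectMatching H
  m′ = perfect-relabel⁻ {G = G} τ m
  e₀₁ : Adj H 0′ 1′
  e₀₁ = subst₂ (Adj G)
    (sym (transpose-other {a = 1′} {partner} {0′} (λ ()) (Adj⇒≢ G (edge (proj₂ (m 0′))))))
    (sym (transpose-left 1′ partner)) (edge (proj₂ (m 0′)))
  functional : ∀ {x y z} → Adj H x y → Adj H x z → y ≡ z
  functional {x} p q = trans (only (proj₂ (m′ x)) p) (sym (only (proj₂ (m′ x)) q))
  ¬e₀ : ∀ {i} → ¬ Adj H 0′ (suc (suc i))
  ¬e₀ {i} p with functional {0′} {1′} {suc (suc i)} e₀₁ p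
  ... | ()
  ¬e₁ : ∀ {i} → ¬ Adj H 1′ (suc (suc i))
  ¬e₁ {i} p with functional {1′} {0′} {suc (suc i)} (Adj-sym H {0′} {1′} e₀₁) p
  ... | ()
  K : Graph n
  K .adj i j = adj H (suc (suc i)) (suc (suc j))
  K .Graph.sym i j = Graph.sym H (suc (suc i)) (suc (suc j))
  K .irrefl i = irrefl H (suc (suc i))
  mK : IsPerfectMatching K
  mK i with m′ (suc (suc i))
  ... | zero , l = ⊥-elim (¬e₀ {i} (Adj-sym H {suc (suc i)} {0′} (edge l)))
  ... | suc zero , l = ⊥-elim (¬e₁ {i} (Adj-sym H {suc (suc i)} {1′} (edge l)))
  ... | suc (suc j) , l = j , leaf (edge l) λ {w} p →
    Fin-suc-injective (Fin-suc-injective (only l {suc (suc w)} p))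
  IH = matching-iso n K mK
  f = proj₁ (proj₂ IH)
  small : ∀ k j → k / 2 ≡ 0 → ⌊ k / 2 ℕ.≟ suc (suc j) / 2 ⌋ ≡ false
  small k j eq = isYes-⇔ (k / 2 ℕ.≟ suc (suc j) / 2) (no id)
    (λ e → 0≢1+n (trans (sym eq) (trans e (half j)))) λ ()
  iso₀ : ∀ j → adj H 0′ (suc (suc j)) ≡ matchingAdj 0′ (suc (suc (f ⟨$⟩ʳ j)))
  iso₀ j = trans (Bool.¬-not (¬e₀ {j})) (sym (cong (_∧ true) (small 0 (toℕ (f ⟨$⟩ʳ j)) refl)))
  iso₁ : ∀ j → adj H 1′ (suc (suc j)) ≡ matchingAdj 1′ (suc (suc (f ⟨$⟩ʳ j)))
  iso₁ j = trans (Bool.¬-not (¬e₁ {j})) (sym (cong (_∧ true) (small 1 (toℕ (f ⟨$⟩ʳ j)) refl)))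
  iso : ∀ i j → adj H i j ≡ matchingAdj (lift₀ (lift₀ f) ⟨$⟩ʳ i) (lift₀ (lift₀ f) ⟨$⟩ʳ j)
  iso zero          zero          = irrefl H 0′
  iso zero          (suc zero)    = e₀₁
  iso zero          (suc (suc j)) = iso₀ j
  iso (suc zero)    zero          = Adj-sym H {0′} {1′} e₀₁
  iso (suc zero)    (suc zero)    = irrefl H 1′
  iso (suc zero)    (suc (suc j)) = iso₁ j
  iso (suc (suc i)) zero          = trans (Graph.sym H (suc (suc i)) 0′)
    (trans (iso₀ i) (matchingAdj-sym 0′ (suc (suc (f ⟨$⟩ʳ i)))))
  iso (suc (suc i)) (suc zero)    = trans (Graph.sym H (suc (suc i)) 1′)
    (trans (iso₁ i) (matchingAdj-sym 1′ (suc (suc (f ⟨$⟩ʳ i)))))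
  iso (suc (suc i)) (suc (suc j)) =
    trans (proj₂ (proj₂ IH) i j) (sym (matchingAdj-suc (f ⟨$⟩ʳ i) (f ⟨$⟩ʳ j)))

theorem1p5 : (n : ℕ) (G F : Graph n) → IsForest F
    → 3 * Δ G + excessLeaves F ≤ n
    → Packs G F ⊎ ((2 ∣ n) × (G ≅ᵃ matchingAdj) × (F ≅ᵃ starAdj))
theorem1p5 n G F forest bound with packs? G F
... | yes p = inj₁ p
... | no np with stuck⇒exceptional _ F ≤-refl forest (Δ G) G bound (deg≤Δ G) np
...   | star , perfect with matching-iso n G perfect
...     | even , π , iso = inj₂ (even , (↔⇒⤖ π , iso) , star-iso F forest star)
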